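{- The sequence $\left(|I_k(132,123)|\right)_{k\ge 1}$ is the Pascal triangle with its first column removed, read row by row: that is, for integers $r\ge 1$ and $1\le j\le r$ and $k=\binom{r}{2}+j$, one has $|I_k(132,123)|=\binom{r}{j}$. The generating function of this sequence, with its first term as constant term, is \[\sum_{k\ge 1}|I_k(132,123)|\,x^{k-1}=\sum_{n\ge 1} x^{(n-2)(n+1)/2}\left((x+1)^n-1\right).\]
   Context: A permutation of length $n$ is a word $\pi=\pi_1\cdots\pi_n$ containing each of $1,\dots,n$ exactly once. The sum of permutations $\rho=\rho_1\cdots\rho_n$ and $\tau=\tau_1\cdots\tau_m$ is the permutation $\rho\oplus\tau=\rho_1\cdots\rho_n(n+\tau_1)\cdots(n+\tau_m)$ of length $n+m$. A permutation is decomposable if it equals $\rho\oplus\tau$ for some non-empty permutations $\rho,\tau$; a non-empty permutation that is not decomposable is indecomposable. An inversion of $\pi$ is a pair $(i,j)$ with $i<j$ and $\pi_i>\pi_j$. A permutation $\pi$ contains a permutation (pattern) $\tau=\tau_1\cdots\tau_m$ if there are indices $i_1<\dots<i_m$ such that $\pi_{i_1},\dots,\pi_{i_m}$ is order-isomorphic to $\tau_1,\dots,\tau_m$; otherwise $\pi$ avoids $\tau$. $I_k(\tau_1,\dots,\tau_r)$ denotes the (finite) set of all indecomposable permutations, of any length, with exactly $k$ inversions that avoid all of $\tau_1,\dots,\tau_r$. The term $n=1$ of the series is $x^{ -1}\cdot x=1$. -}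

module Defs where

open import Data.Nat.Base as ℕ using (ℕ; zero; suc; _≤_; _∸_)
import Data.Nat.Properties as ℕ
open import Data.Integer.Base as ℤ using (ℤ; +_; -[1+_]; 0ℤ; 1ℤ)
open import Data.Fin.Base as Fin using (Fin; toℕ)
import Data.Fin.Properties as Fin
open import Data.List.Base
  using (List; []; _∷_; _++_; map; length; lookup; filter; allFin; applyUpTo; cartesianProduct)
open import Data.List.Membership.Propositional using (_∈_)
open import Data.List.Relation.Unary.All using (All)
open import Data.List.Relation.Unary.Unique.Propositional using (Unique)
open import Data.List.Relation.Binary.Permutation.Propositional using (_↭_)
open import Data.Product using (_×_; _,_; ∃-syntax; Σ-syntax)
open import Algebra.Definitions.RawMonoid ℤ.+-0-rawMonoid using (sum)
open import Function.Bundles using (_⇔_)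
open import Relation.Binary.PropositionalEquality using (_≡_; _≢_)
open import Relation.Nullary using (¬_; Dec)
open import Relation.Nullary.Decidable using (_×-dec_)
open import Relation.Unary using (Pred)
open import Level using (0ℓ)

Word : Set
Word = List ℕ

IsPermutation : Pred Word 0ℓ
IsPermutation π = π ↭ applyUpTo suc (length π)

infixr 6 _⊕_
_⊕_ : Word → Word → Word
ρ ⊕ τ = ρ ++ map (length ρ ℕ.+_) τ

Decomposable : Pred Word 0ℓ
Decomposable π =
  ∃[ ρ ] ∃[ τ ] IsPermutation ρ × IsPermutation τ × ρ ≢ [] × τ ≢ [] × π ≡ ρ ⊕ τ

Indecomposable : Pred Word 0ℓ
Indecomposable π = π ≢ [] × ¬ Decomposable π

Inversion : (π : Word) → Pred (Fin (length π) × Fin (length π)) 0ℓ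
Inversion π (i , j) = i Fin.< j × lookup π i ℕ.> lookup π j

inversion? : (π : Word) → ∀ p → Dec (Inversion π p)
inversion? π (i , j) = (i Fin.<? j) ×-dec (lookup π j ℕ.<? lookup π i)

inversions : Word → ℕ
inversions π =
  length (filter (inversion? π) (cartesianProduct (allFin (length π)) (allFin (length π))))

Contains : Word → Word → Set
Contains π τ =
  Σ[ i ∈ (Fin (length τ) → Fin (length π)) ]
    (∀ {a b} → a Fin.< b → i a Fin.< i b) ×
    (∀ a b → lookup π (i a) ℕ.< lookup π (i b) ⇔ lookup τ a ℕ.< lookup τ b)

Avoids : Word → Word → Set
Avoids π τ = ¬ Contains π τ

I : ℕ → List Word → Pred Word 0ℓ
I k τs π =
  IsPermutation π × Indecomposable π × inversions π ≡ k × All (Avoids π) τs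

HasCardinality : Pred Word 0ℓ → ℕ → Set
HasCardinality P n =
  ∃[ ws ] Unique ws × (∀ w → w ∈ ws ⇔ P w) × length ws ≡ n

-- Formal power series over ℤ, given by their coefficients.
PowerSeries : Set
PowerSeries = ℕ → ℤ

1ₛ : PowerSeries
1ₛ zero    = 1ℤ
1ₛ (suc _) = 0ℤ

x : PowerSeries
x 1 = 1ℤ
x _ = 0ℤ

infixl 6 _+ₛ_ _-ₛ_
infixl 7 _*ₛ_
infixr 8 _^ₛ_

_+ₛ_ _-ₛ_ _*ₛ_ : PowerSeries → PowerSeries → PowerSeries
(f +ₛ g) m = f m ℤ.+ g m
(f -ₛ g) m = f m ℤ.- g m
(f *ₛ g) m = sum {suc m} (λ i → f (toℕ i) ℤ.* g (m ∸ toℕ i))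

_^ₛ_ : PowerSeries → ℕ → PowerSeries
f ^ₛ zero  = 1ₛ
f ^ₛ suc n = f *ₛ (f ^ₛ n)

-- Series in x and x⁻¹: the factor x^((n-2)(n+1)/2) is x⁻¹ at n = 1, so the
-- summands have to be formed where negative exponents are available.
LaurentSeries : Set
LaurentSeries = ℤ → ℤ

toLaurent : PowerSeries → LaurentSeries
toLaurent f (+ m)    = f m
toLaurent f -[1+ _ ] = 0ℤ

infixr 7 x^_·_
x^_·_ : ℤ → LaurentSeries → LaurentSeries
(x^ e · f) m = f (m ℤ.- e)

-- Floor division, exact here since (n-2)(n+1) is even.
exponent : ℕ → ℤ
exponent n = ((+ n ℤ.- + 2) ℤ.* (+ n ℤ.+ + 1)) ℤ./ + 2

-- Σ_{n ≥ 1} t n = F coefficientwise: every coefficient of the partial sums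
-- t 1 + ⋯ + t N is eventually constant, with the coefficient of F as its value.
Σₙ≥1_≈_ : (ℕ → LaurentSeries) → LaurentSeries → Set
Σₙ≥1 t ≈ F =
  ∀ m → ∃[ N₀ ] ∀ N → N₀ ≤ N → sum {N} (λ i → t (suc (toℕ i)) m) ≡ F m

{-# OPTIONS --safe #-}
module Submission where

-- A permutation avoids 132 and 123 exactly when every entry has at most one
-- larger entry to its right.  Such a permutation of length r + 1 is read from
-- left to right: the letters not yet used always form an interval 1, ..., m
-- together with one larger letter M, and the next letter can only be M or m,
-- since any smaller one would leave both m and M to its right.  After M the
-- letter m takes over the role of M.  The r choices are recorded by a subset s
-- of an r-element set (inside: emit M; outside: emit m), and s ↦ word s (r + 1)
-- is a bijection onto the avoiding permutations of length r + 1
-- (word-injective, word-oneLarger, oneLarger-complete, avoids⇒oneLarger).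
--
-- The word of s has C(r,2) + ∣s∣ inversions (word-inversions).  It is
-- decomposable only for r ≥ 1 and ∣s∣ = 0, when it is r ... 1 (r+1)
-- (word-split, word-decomposable).  Hence, for k ≥ 1, the set I_k(132,123)
-- corresponds to the pairs r, s with k = C(r,2) + ∣s∣ and 1 ≤ ∣s∣ ≤ r.  As the intervals
-- C(r,2) < k ≤ C(r+1,2) tile the positive integers, r and ∣s∣ = j are
-- determined by k (locate, cell-unique), and there are C(r,j) such s.
--
-- For the generating function, (n-2)(n+1)/2 = C(n,2) - 1, so the coefficient of
-- x^(k-1) in the n-th summand is C(n, k - C(n,2)) if k > C(n,2), and 0 otherwise.
-- This vanishes unless n is the row r of k (term-other), and for n = r it
-- is C(r,j) (term->).

open import Defs
open import Data.Nat.Base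
  using (ℕ; zero; suc; _+_; _∸_; _*_; _≤_; _<_; z≤n; s≤s; s<s⁻¹; s≤s⁻¹)
open import Data.Nat.Combinatorics using (_C_; nC1≡n; k>n⇒nCk≡0; nCk+nC[k+1]≡[n+1]C[k+1])
open import Data.Nat.DivMod using (_/_; m*n/n≡m)
open import Data.Nat.Properties
open import Data.Nat.Tactic.RingSolver using (solve-∀)
open import Data.Integer.Base as ℤ using (ℤ; +_; -[1+_]; 0ℤ; 1ℤ; _⊖_)
import Data.Integer.Properties as ℤ
open import Algebra.Definitions.RawMonoid ℤ.+-0-rawMonoid using (sum)
open import Algebra.Properties.Monoid.Sum ℤ.+-0-monoid using (sum-cong-≗; sum-replicate-zero)
open import Data.Empty using (⊥; ⊥-elim)
open import Data.Fin.Base as Fin using (Fin; zero; suc; toℕ)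
open import Data.Fin.Patterns using (0F; 1F; 2F)
import Data.Fin.Properties as Fin
open import Data.Fin.Subset using (Subset; inside; outside; ∣_∣)
open import Data.Fin.Subset.Properties using (∣p∣≤n)
open import Data.List.Base
  using (List; []; _∷_; _++_; _∷ʳ_; [_]; map; length; lookup; filter; allFin;
         applyUpTo; applyDownFrom; cartesianProduct)
open import Data.List.Properties
  using (∷-injectiveˡ; ∷-injectiveʳ; length-map; length-++; length-applyUpTo; filter-all;
         filter-reject; filter-++; filter-≐; map-tabulate; tabulate-lookup; applyUpTo-∷ʳ;
         length-applyDownFrom; reverse-applyUpTo)
open import Data.List.Membership.Propositional using (_∈_)
open import Data.List.Membership.Propositional.Properties
  using (∈-lookup; ∈-applyUpTo⁺; ∈-applyUpTo⁻; ∈-map⁺; ∈-map⁻; ∈-++⁺ˡ; ∈-++⁺ʳ; ∈-++⁻)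
open import Data.List.Relation.Unary.All as All using (All; []; _∷_)
import Data.List.Relation.Unary.All.Properties as All
open import Data.List.Relation.Unary.AllPairs using ([]; _∷_)
open import Data.List.Relation.Unary.Any using (here; there; index)
open import Data.List.Relation.Unary.Any.Properties using (lookup-index)
open import Data.List.Relation.Unary.Unique.Propositional using (Unique)
import Data.List.Relation.Unary.Unique.Propositional.Properties as Unique
open import Data.List.Relation.Binary.Permutation.Propositional
  using (_↭_; prep; swap; ↭-refl; ↭-reflexive; ↭-sym; ↭-trans; ↭⇒↭ₛ)
open import Data.List.Relation.Binary.Permutation.Propositional.Properties
  using (∈-resp-↭; ↭-length; ↭-singleton-inv; ¬x∷xs↭[]; drop-∷; ∷↭∷ʳ; ↭-reverse; filter-↭)
import Data.List.Relation.Binary.Permutation.Setoid.Properties as SetoidPermutation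
open import Data.Product using (_×_; _,_; proj₁; proj₂; Σ-syntax; ∃-syntax)
open import Data.Sum using (_⊎_; inj₁; inj₂; [_,_]′)
open import Data.Vec.Base using ([]; _∷_)
import Data.Vec.Properties as Vec
open import Function.Base using (_∘_; id)
open import Function.Bundles using (_⇔_; mk⇔; Equivalence)
open import Level using (0ℓ)
open import Relation.Binary.Definitions using (tri<; tri≈; tri>)
open import Relation.Binary.PropositionalEquality
  using (_≡_; _≢_; refl; sym; trans; cong; cong₂; subst; setoid; module ≡-Reasoning)
open import Relation.Nullary using (¬_; yes; no; contradiction)
open import Relation.Unary using (Pred; Decidable)

private
  variable
    m n r j k M a : ℕ
    A B : Set

-- Triangular numbers and positions in Pascal's triangle

triangle-suc : ∀ m → suc m C 2 ≡ m + m C 2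
triangle-suc m = trans (sym (nCk+nC[k+1]≡[n+1]C[k+1] m 1)) (cong (_+ m C 2) (nC1≡n m))

triangle-mono : m ≤ n → m C 2 ≤ n C 2
triangle-mono {n = zero}  z≤n = ≤-refl
triangle-mono {m} {suc n} m≤1+n with m≤n⇒m<n∨m≡n m≤1+n
... | inj₂ refl = ≤-refl
... | inj₁ m<1+n = begin
  m C 2      ≤⟨ triangle-mono (s≤s⁻¹ m<1+n) ⟩
  n C 2      ≤⟨ m≤n+m (n C 2) n ⟩
  n + n C 2  ≡⟨ triangle-suc n ⟨
  suc n C 2  ∎
  where open ≤-Reasoning

-- The positive integers are cut into blocks of sizes 1, 2, 3, ..., the r-th one
-- starting right after C(r,2); Cell k r j says that k is the j-th number of the
-- r-th block, with r and j counted from 1.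
record Cell (k r j : ℕ) : Set where
  constructor cell
  field
    1≤j : 1 ≤ j
    j≤r : j ≤ r
    k≡  : k ≡ r C 2 + j

open Cell

cell-≤-next : Cell k r j → r < n → k ≤ n C 2
cell-≤-next {k} {r} {j} {n} c r<n = begin
  k          ≡⟨ k≡ c ⟩
  r C 2 + j  ≤⟨ +-monoʳ-≤ (r C 2) (j≤r c) ⟩
  r C 2 + r  ≡⟨ +-comm (r C 2) r ⟩
  r + r C 2  ≡⟨ triangle-suc r ⟨
  suc r C 2  ≤⟨ triangle-mono r<n ⟩
  n C 2      ∎
  where open ≤-Reasoning

cell-> : Cell k r j → r C 2 < k
cell-> {r = r} {j} c = subst (r C 2 <_) (sym (k≡ c)) (m<m+n (r C 2) (1≤j c))

cell-unique : ∀ {r′ j′} → Cell k r j → Cell k r′ j′ → r ≡ r′ × j ≡ j′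
cell-unique {k} {r} {j} {r′} {j′} c c′ with <-cmp r r′
... | tri< r<r′ _ _ = contradiction (cell-> c′) (≤⇒≯ (cell-≤-next c r<r′))
... | tri> _ _ r′<r = contradiction (cell-> c) (≤⇒≯ (cell-≤-next c′ r′<r))
... | tri≈ _ refl _ = refl , +-cancelˡ-≡ (r C 2) j j′ (trans (sym (k≡ c)) (k≡ c′))

-- Every positive integer lies in some block; k = 0 lies in none.
locate : ∀ p → ∃[ r ] ∃[ j ] Cell (suc p) r j
locate zero = 1 , 1 , cell ≤-refl ≤-refl refl
locate (suc p) with locate p
... | r , j , c with m≤n⇒m<n∨m≡n (j≤r c)
...   | inj₁ j<r = r , suc j , cell (s≤s z≤n) j<r (trans (cong suc (k≡ c)) (sym (+-suc (r C 2) j)))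
-- The last number of a block is followed by the first one of the next block.
...   | inj₂ refl = suc r , 1 , cell ≤-refl (s≤s z≤n) (begin
        suc (suc p)        ≡⟨ cong suc (k≡ c) ⟩
        suc (r C 2 + r)    ≡⟨ cong suc (+-comm (r C 2) r) ⟩
        suc (r + r C 2)    ≡⟨ cong suc (triangle-suc r) ⟨
        suc (suc r C 2)    ≡⟨ +-comm 1 _ ⟩
        suc r C 2 + 1      ∎)
  where open ≡-Reasoning

-- Subsets of given size

-- All subsets of an m-element set that have j elements.
subsets : ∀ m → ℕ → List (Subset m)
subsets zero    zero    = [ [] ]
subsets zero    (suc j) = []
subsets (suc m) zero    = map (outside ∷_) (subsets m zero)
subsets (suc m) (suc j) = map (inside ∷_) (subsets m j) ++ map (outside ∷_) (subsets m (suc j))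

length-subsets : ∀ m j → length (subsets m j) ≡ m C j
length-subsets zero    zero    = refl
length-subsets zero    (suc j) = refl
length-subsets (suc m) zero    = trans (length-map _ (subsets m zero)) (length-subsets m zero)
length-subsets (suc m) (suc j) = begin
  length (subsets (suc m) (suc j))
    ≡⟨ length-++ (map (inside ∷_) (subsets m j)) ⟩
  length (map (inside ∷_) (subsets m j)) + length (map (outside ∷_) (subsets m (suc j)))
    ≡⟨ cong₂ _+_ (length-map _ (subsets m j)) (length-map _ (subsets m (suc j))) ⟩
  length (subsets m j) + length (subsets m (suc j))
    ≡⟨ cong₂ _+_ (length-subsets m j) (length-subsets m (suc j)) ⟩
  m C j + m C suc j
    ≡⟨ nCk+nC[k+1]≡[n+1]C[k+1] m j ⟩
  suc m C suc j ∎
  where open ≡-Reasoning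

subsets-unique : ∀ m j → Unique (subsets m j)
subsets-unique zero    zero    = [] ∷ []
subsets-unique zero    (suc j) = []
subsets-unique (suc m) zero    = Unique.map⁺ Vec.∷-injectiveʳ (subsets-unique m zero)
subsets-unique (suc m) (suc j) =
  Unique.++⁺ (Unique.map⁺ Vec.∷-injectiveʳ (subsets-unique m j))
             (Unique.map⁺ Vec.∷-injectiveʳ (subsets-unique m (suc j)))
             disjoint
  where
  disjoint : ∀ {s} → ¬ (s ∈ map (inside ∷_) (subsets m j) × s ∈ map (outside ∷_) (subsets m (suc j)))
  disjoint (p , q) with ∈-map⁻ (inside ∷_) p | ∈-map⁻ (outside ∷_) q
  ... | _ , _ , refl | _ , _ , ()

∈-subsets⁺ : (s : Subset m) → s ∈ subsets m ∣ s ∣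
∈-subsets⁺ []            = here refl
∈-subsets⁺ (inside ∷ s)  = ∈-++⁺ˡ (∈-map⁺ _ (∈-subsets⁺ s))
∈-subsets⁺ {suc m} (outside ∷ s) with ∣ s ∣ | ∈-subsets⁺ s
... | zero  | s∈ = ∈-map⁺ _ s∈
... | suc j | s∈ = ∈-++⁺ʳ (map (inside ∷_) (subsets m j)) (∈-map⁺ _ s∈)

∈-subsets⁻ : ∀ j {s : Subset m} → s ∈ subsets m j → ∣ s ∣ ≡ j
∈-subsets⁻ {zero}  zero    (here refl) = refl
∈-subsets⁻ {suc m} zero    s∈ with ∈-map⁻ (outside ∷_) s∈
... | _ , t∈ , refl = ∈-subsets⁻ zero t∈
∈-subsets⁻ {suc m} (suc j) s∈ with ∈-++⁻ (map (inside ∷_) (subsets m j)) s∈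
... | inj₁ p with _ , t∈ , refl ← ∈-map⁻ (inside ∷_) p = cong suc (∈-subsets⁻ j t∈)
... | inj₂ p with _ , t∈ , refl ← ∈-map⁻ (outside ∷_) p = ∈-subsets⁻ (suc j) t∈

-- Words of subsets

-- The arrangement of the letters 1, ..., m and M encoded by a subset of an
-- m-element set.  If m < M, each choice emits the largest remaining letter M
-- (inside), so that m becomes the largest, or the second largest letter m
-- (outside); the letter left over at the end comes last.
word : Subset m → ℕ → Word
word             []            M = [ M ]
word {m = suc m} (inside ∷ s)  M = M ∷ word s (suc m)
word {m = suc m} (outside ∷ s) M = suc m ∷ word s M

interval-suc : ∀ m → applyUpTo suc (suc m) ↭ suc m ∷ applyUpTo suc m
interval-suc m = ↭-sym (↭-trans (∷↭∷ʳ (suc m) _) (↭-reflexive (applyUpTo-∷ʳ suc m)))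

interval-swap : ∀ M m → M ∷ applyUpTo suc (suc m) ↭ suc m ∷ M ∷ applyUpTo suc m
interval-swap M m = ↭-trans (prep M (interval-suc m)) (swap M (suc m) ↭-refl)

∈-interval⁻ : a ∈ applyUpTo suc m → 1 ≤ a × a ≤ m
∈-interval⁻ p with ∈-applyUpTo⁻ suc p
... | _ , i<m , refl = s≤s z≤n , i<m

word-↭ : (s : Subset m) → ∀ M → word s M ↭ M ∷ applyUpTo suc m
word-↭             []            M = ↭-refl
word-↭ {m = suc m} (inside ∷ s)  M =
  prep M (↭-trans (word-↭ s (suc m)) (↭-sym (interval-suc m)))
word-↭ {m = suc m} (outside ∷ s) M =
  ↭-trans (prep (suc m) (word-↭ s M)) (↭-sym (interval-swap M m))

length-word : (s : Subset m) → ∀ M → length (word s M) ≡ suc m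
length-word s M = trans (↭-length (word-↭ s M)) (cong suc (length-applyUpTo suc _))

∈-word⁻ : (s : Subset m) → ∀ M → a ∈ word s M → a ≡ M ⊎ a ≤ m
∈-word⁻ s M a∈ with ∈-resp-↭ (word-↭ s M) a∈
... | here refl = inj₁ refl
... | there p   = inj₂ (proj₂ (∈-interval⁻ p))

word-isPermutation : (s : Subset m) → IsPermutation (word s (suc m))
word-isPermutation {m} s rewrite length-word s (suc m) =
  ↭-trans (word-↭ s (suc m)) (↭-sym (interval-suc m))

Unique-resp-↭ : {xs ys : List A} → xs ↭ ys → Unique xs → Unique ys
Unique-resp-↭ {A} xs↭ys = SetoidPermutation.Unique-resp-↭ (setoid A) (↭⇒↭ₛ xs↭ys)

interval-unique : ∀ m → Unique (applyUpTo suc m)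
interval-unique m = Unique.applyUpTo⁺₁ suc m (λ i<j _ → <⇒≢ i<j ∘ suc-injective)

word-unique : (s : Subset m) → m < M → Unique (word s M)
word-unique {m} {M} s m<M = Unique-resp-↭ (↭-sym (word-↭ s M))
  (All.tabulate (λ y∈ → >⇒≢ (≤-<-trans (proj₂ (∈-interval⁻ y∈)) m<M)) ∷ interval-unique m)

word-injective : (s t : Subset m) → m < M → word s M ≡ word t M → s ≡ t
word-injective []            []            _   _  = refl
word-injective (inside ∷ s)  (inside ∷ t)  m<M eq =
  cong (inside ∷_) (word-injective s t ≤-refl (∷-injectiveʳ eq))
word-injective (outside ∷ s) (outside ∷ t) m<M eq =
  cong (outside ∷_) (word-injective s t (<⇒≤ m<M) (∷-injectiveʳ eq))
word-injective (inside ∷ s)  (outside ∷ t) m<M eq = contradiction (∷-injectiveˡ eq) (>⇒≢ m<M)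
word-injective (outside ∷ s) (inside ∷ t)  m<M eq = contradiction (∷-injectiveˡ eq) (<⇒≢ m<M)

-- Decomposability

nonempty-∃ : {xs : List A} → xs ≢ [] → ∃[ y ] y ∈ xs
nonempty-∃ {xs = []}    ≢[] = contradiction refl ≢[]
nonempty-∃ {xs = y ∷ _} _   = y , here refl

-- Only the word of the empty subset can be cut into a lower part ρ and a higher
-- part τ, both nonempty.  If M is the first letter, it lies in ρ and exceeds all
-- of τ; if the first letter is m > 1 and forms ρ by itself, then τ contains 1.
word-split : (s : Subset m) → m < M → ∀ ρ {τ} → ρ ≢ [] → τ ≢ [] →
             (∀ {a b} → a ∈ ρ → b ∈ τ → a < b) → word s M ≡ ρ ++ τ → ∣ s ∣ ≡ 0
word-split s m<M [] ρ≢[] _ _ _ = contradiction refl ρ≢[]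
word-split [] _ _ _ _ _ _ = refl
word-split (inside ∷ s) m<M (_ ∷ ρ) _ τ≢[] ρ<τ eq
  with refl ← ∷-injectiveˡ eq | b , b∈τ ← nonempty-∃ τ≢[]
  with ∈-word⁻ s _ (subst (b ∈_) (sym (∷-injectiveʳ eq)) (∈-++⁺ʳ ρ b∈τ))
... | inj₁ refl = contradiction (ρ<τ (here refl) b∈τ) (<-asym m<M)
... | inj₂ b≤m  = contradiction (ρ<τ (here refl) b∈τ) (<-asym (≤-<-trans b≤m (<⇒≤ m<M)))
word-split (outside ∷ []) _ _ _ _ _ _ = refl
word-split {M = M} (outside ∷ s@(_ ∷ _)) m<M (_ ∷ []) _ _ ρ<τ eq
  with refl ← ∷-injectiveˡ eq
  = contradiction (ρ<τ (here refl) (subst (1 ∈_) (∷-injectiveʳ eq) 1∈)) (λ { (s≤s ()) })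
  where
  1∈ : 1 ∈ word s M
  1∈ = ∈-resp-↭ (↭-sym (word-↭ s M)) (there (here refl))
word-split (outside ∷ s@(_ ∷ _)) m<M (_ ∷ ρ@(_ ∷ _)) _ τ≢[] ρ<τ eq =
  word-split s (<⇒≤ m<M) ρ (λ ()) τ≢[] (ρ<τ ∘ there) (∷-injectiveʳ eq)

-- The entries of the first summand lie below those of the second.
⊕-< : ∀ {ρ τ a b} → IsPermutation ρ → IsPermutation τ → a ∈ ρ → b ∈ map (λ t → length ρ + t) τ → a < b
⊕-< {ρ} pρ pτ a∈ b∈ with ∈-map⁻ _ b∈
... | c , c∈ , refl = ≤-<-trans (proj₂ (∈-interval⁻ (∈-resp-↭ pρ a∈)))
                                (m<m+n (length ρ) (proj₁ (∈-interval⁻ (∈-resp-↭ pτ c∈))))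

word-indecomposable : (s : Subset m) → 1 ≤ ∣ s ∣ → Indecomposable (word s (suc m))
word-indecomposable {m} s 1≤∣s∣ = word≢[] s , λ where
    (ρ , τ , pρ , pτ , ρ≢[] , τ≢[] , eq) →
      <⇒≢ 1≤∣s∣ (sym (word-split s ≤-refl ρ ρ≢[] (τ≢[] ∘ map-≡[] τ) (⊕-< pρ pτ) eq))
  where
  word≢[] : ∀ {m M} (s : Subset m) → word s M ≢ []
  word≢[] []            ()
  word≢[] (inside ∷ _)  ()
  word≢[] (outside ∷ _) ()
  map-≡[] : ∀ {f : A → B} xs → map f xs ≡ [] → xs ≡ []
  map-≡[] [] _ = refl

-- The empty subset emits m, ..., 1 and keeps M to the end.
word-empty : (s : Subset m) → ∀ M → ∣ s ∣ ≡ 0 → word s M ≡ applyDownFrom suc m ∷ʳ M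
word-empty []            M _  = refl
word-empty (outside ∷ s) M eq = cong (_ ∷_) (word-empty s M eq)

applyDownFrom-↭ : ∀ (f : ℕ → A) n → applyDownFrom f n ↭ applyUpTo f n
applyDownFrom-↭ f n = ↭-trans (↭-reflexive (sym (reverse-applyUpTo f n))) (↭-reverse _)

word-decomposable : (s : Subset (suc m)) → ∣ s ∣ ≡ 0 → Decomposable (word s (2 + m))
word-decomposable {m} s ∣s∣≡0 =
  ρ , [ 1 ] , pρ , ↭-refl , (λ ()) , (λ ()) ,
  trans (word-empty s (2 + m) ∣s∣≡0) (cong (λ l → ρ ∷ʳ l) eq)
  where
  ρ : Word
  ρ = applyDownFrom suc (suc m)
  pρ : IsPermutation ρ
  pρ = subst (λ l → ρ ↭ applyUpTo suc l)
             (sym (length-applyDownFrom suc (suc m))) (applyDownFrom-↭ suc (suc m))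
  eq : 2 + m ≡ length ρ + 1
  eq = trans (+-comm 1 (suc m)) (cong (_+ 1) (sym (length-applyDownFrom suc (suc m))))

-- Counting inversions

module _ {P : Pred A 0ℓ} (P? : Decidable P) where

  length-filter-map : (f : B → A) → ∀ xs →
                      length (filter P? (map f xs)) ≡ length (filter (P? ∘ f) xs)
  length-filter-map f []       = refl
  length-filter-map f (x ∷ xs) with P? (f x)
  ... | yes _ = cong suc (length-filter-map f xs)
  ... | no  _ = length-filter-map f xs

  length-filter-++ : ∀ xs ys → length (filter P? (xs ++ ys)) ≡ length (filter P? xs) + length (filter P? ys)
  length-filter-++ xs ys = trans (cong length (filter-++ P? xs ys)) (length-++ (filter P? xs))

-- If no pair (i , 0) with i > 0 satisfies P, then the column j = 0 can be dropped
-- when counting the pairs with i > 0.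
module _ {P : Pred (Fin (suc m) × Fin (suc n)) 0ℓ} (P? : Decidable P) (P-col : ∀ i → ¬ P (suc i , zero)) where

  length-filter-minor : ∀ xs ys →
    length (filter P? (cartesianProduct (map suc xs) (zero ∷ map suc ys)))
      ≡ length (filter (λ (i , j) → P? (suc i , suc j)) (cartesianProduct xs ys))
  length-filter-minor []       ys = refl
  length-filter-minor (x ∷ xs) ys = begin
    length (filter P? (row ++ cartesianProduct (map suc xs) (zero ∷ map suc ys)))
      ≡⟨ length-filter-++ P? row _ ⟩
    length (filter P? row) + length (filter P? (cartesianProduct (map suc xs) (zero ∷ map suc ys)))
      ≡⟨ cong₂ _+_ row-eq (length-filter-minor xs ys) ⟩
    length (filter (Q? ∘ (x ,_)) ys) + length (filter Q? (cartesianProduct xs ys))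
      ≡⟨ cong (_+ length (filter Q? (cartesianProduct xs ys))) (length-filter-map Q? (x ,_) ys) ⟨
    length (filter Q? (map (x ,_) ys)) + length (filter Q? (cartesianProduct xs ys))
      ≡⟨ length-filter-++ Q? (map (x ,_) ys) _ ⟨
    length (filter Q? (map (x ,_) ys ++ cartesianProduct xs ys)) ∎
    where
    open ≡-Reasoning
    row = map (suc x ,_) (zero ∷ map suc ys)
    Q? = λ ((i , j) : Fin m × Fin n) → P? (suc i , suc j)
    row-eq : length (filter P? row) ≡ length (filter (Q? ∘ (x ,_)) ys)
    row-eq = begin
      length (filter P? row)
        ≡⟨ cong length (filter-reject P? (P-col x)) ⟩
      length (filter P? (map (suc x ,_) (map suc ys)))
        ≡⟨ length-filter-map P? (suc x ,_) (map suc ys) ⟩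
      length (filter (P? ∘ (suc x ,_)) (map suc ys))
        ≡⟨ length-filter-map (P? ∘ (suc x ,_)) suc ys ⟩
      length (filter (Q? ∘ (x ,_)) ys) ∎

allFin-suc : ∀ n → allFin (suc n) ≡ zero ∷ map suc (allFin n)
allFin-suc n = cong (zero ∷_) (sym (map-tabulate id suc))

-- The inversions that involve the first letter a are the smaller letters after it.
inversions-∷ : ∀ a w → inversions (a ∷ w) ≡ length (filter (_<? a) w) + inversions w
inversions-∷ a w = begin
  length (filter P? (cartesianProduct (allFin (suc (length w))) (allFin (suc (length w)))))
    ≡⟨ cong (λ is → length (filter P? (cartesianProduct is is))) (allFin-suc (length w)) ⟩
  length (filter P? (row ++ cartesianProduct (map suc is) (zero ∷ map suc is)))
    ≡⟨ length-filter-++ P? row _ ⟩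
  length (filter P? row) + length (filter P? (cartesianProduct (map suc is) (zero ∷ map suc is)))
    ≡⟨ cong₂ _+_ row-eq (length-filter-minor P? (λ _ → λ ()) is is) ⟩
  length (filter (_<? a) w) + length (filter (λ (i , j) → P? (suc i , suc j)) (cartesianProduct is is))
    ≡⟨ cong (λ ps → length (filter (_<? a) w) + length ps)
         (filter-≐ _ (inversion? w)
           ((λ (i<j , v) → s<s⁻¹ i<j , v) , (λ (i<j , v) → s≤s i<j , v))
           (cartesianProduct is is)) ⟩
  length (filter (_<? a) w) + inversions w ∎
  where
  open ≡-Reasoning
  is = allFin (length w)
  P? = inversion? (a ∷ w)
  row = map (zero ,_) (zero ∷ map suc is)
  row-eq : length (filter P? row) ≡ length (filter (_<? a) w)
  row-eq = begin
    length (filter P? row)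
      ≡⟨ cong length (filter-reject P? {x = zero , zero} {xs = map (zero ,_) (map suc is)} (λ ())) ⟩
    length (filter P? (map (zero ,_) (map suc is)))
      ≡⟨ length-filter-map P? (zero ,_) (map suc is) ⟩
    length (filter (P? ∘ (zero ,_)) (map suc is))
      ≡⟨ length-filter-map (P? ∘ (zero ,_)) suc is ⟩
    length (filter (λ j → P? (zero , suc j)) is)
      ≡⟨ cong length (filter-≐ _ (λ j → lookup w j <? a) (proj₂ , (s≤s z≤n ,_)) is) ⟩
    length (filter (λ j → lookup w j <? a) is)
      ≡⟨ length-filter-map (_<? a) (lookup w) is ⟨
    length (filter (_<? a) (map (lookup w) is))
      ≡⟨ cong (length ∘ filter (_<? a)) (trans (map-tabulate id (lookup w)) (tabulate-lookup w)) ⟩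
    length (filter (_<? a) w) ∎

-- A first letter M exceeds all letters after it; a first letter from the interval
-- exceeds all of them but M.
word-inversions : (s : Subset m) → m < M → inversions (word s M) ≡ m C 2 + ∣ s ∣
word-inversions {M = M} [] _ = inversions-∷ M []
word-inversions {suc m} {M} (inside ∷ s) m<M = begin
  inversions (M ∷ word s (suc m))
    ≡⟨ inversions-∷ M (word s (suc m)) ⟩
  length (filter (_<? M) (word s (suc m))) + inversions (word s (suc m))
    ≡⟨ cong₂ _+_ (trans (cong length (filter-all (_<? M) all<M)) (length-word s (suc m)))
                  (word-inversions s ≤-refl) ⟩
  suc m + (m C 2 + ∣ s ∣)
    ≡⟨ cong suc (+-assoc m (m C 2) ∣ s ∣) ⟨
  suc (m + m C 2 + ∣ s ∣)
    ≡⟨ +-suc (m + m C 2) ∣ s ∣ ⟨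
  m + m C 2 + suc ∣ s ∣
    ≡⟨ cong (_+ suc ∣ s ∣) (triangle-suc m) ⟨
  suc m C 2 + suc ∣ s ∣ ∎
  where
  open ≡-Reasoning
  all<M : All (_< M) (word s (suc m))
  all<M = All.tabulate λ b∈ → [ (λ { refl → m<M }) , (λ b≤m → ≤-<-trans b≤m (<⇒≤ m<M)) ]′ (∈-word⁻ s _ b∈)
word-inversions {suc m} {M} (outside ∷ s) m<M = begin
  inversions (suc m ∷ word s M)
    ≡⟨ inversions-∷ (suc m) (word s M) ⟩
  length (filter (_<? suc m) (word s M)) + inversions (word s M)
    ≡⟨ cong₂ _+_ smaller (word-inversions s (<⇒≤ m<M)) ⟩
  m + (m C 2 + ∣ s ∣)
    ≡⟨ +-assoc m (m C 2) ∣ s ∣ ⟨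
  m + m C 2 + ∣ s ∣
    ≡⟨ cong (_+ ∣ s ∣) (triangle-suc m) ⟨
  suc m C 2 + ∣ s ∣ ∎
  where
  open ≡-Reasoning
  smaller : length (filter (_<? suc m) (word s M)) ≡ m
  smaller = begin
    length (filter (_<? suc m) (word s M))
      ≡⟨ ↭-length (filter-↭ (_<? suc m) (word-↭ s M)) ⟩
    length (filter (_<? suc m) (M ∷ applyUpTo suc m))
      ≡⟨ cong length (filter-reject (_<? suc m) (<⇒≯ m<M)) ⟩
    length (filter (_<? suc m) (applyUpTo suc m))
      ≡⟨ cong length (filter-all (_<? suc m) (All.applyUpTo⁺₁ suc m s≤s)) ⟩
    length (applyUpTo suc m)
      ≡⟨ length-applyUpTo suc m ⟩
    m ∎

-- Avoiding 132 and 123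

-- Every entry has at most one larger entry to its right.
OneLarger : Word → Set
OneLarger w = ∀ {p q t} → p Fin.< q → q Fin.< t → lookup w p < lookup w q → ¬ (lookup w p < lookup w t)

lookup-≢ : {xs : List A} → Unique xs → ∀ {i j} → i Fin.< j → lookup xs i ≢ lookup xs j
lookup-≢ (x≢ ∷ _) {zero}  {suc j} _   = All.lookup x≢ (∈-lookup j)
lookup-≢ (_ ∷ u)  {suc i} {suc j} i<j = lookup-≢ u (s<s⁻¹ i<j)

word-oneLarger : (s : Subset m) → m < M → OneLarger (word s M)
word-oneLarger [] _ {zero} {zero} ()
word-oneLarger {suc m} (inside ∷ s) m<M {zero} {suc q} _ _ p<q _ with ∈-word⁻ s (suc m) (∈-lookup q)
... | inj₁ eq = <-asym m<M (subst (_ <_) eq p<q)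
... | inj₂ ≤m = <-asym (≤-<-trans ≤m (<⇒≤ m<M)) p<q
word-oneLarger (inside ∷ s) m<M {suc p} {suc q} {suc t} p<q q<t =
  word-oneLarger s ≤-refl (s<s⁻¹ p<q) (s<s⁻¹ q<t)
word-oneLarger {suc m} {M} (outside ∷ s) m<M {zero} {suc q} {suc t} _ q<t p<q p<t =
  lookup-≢ (word-unique s (<⇒≤ m<M)) (s<s⁻¹ q<t) (trans (is-M q p<q) (sym (is-M t p<t)))
  where
  is-M : ∀ i → suc m < lookup (word s M) i → lookup (word s M) i ≡ M
  is-M i m<i with ∈-word⁻ s M (∈-lookup i)
  ... | inj₁ eq = eq
  ... | inj₂ ≤m = contradiction (<⇒≤ m<i) (≤⇒≯ ≤m)
word-oneLarger (outside ∷ s) m<M {suc p} {suc q} {suc t} p<q q<t =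
  word-oneLarger s (<⇒≤ m<M) (s<s⁻¹ p<q) (s<s⁻¹ q<t)

-- Conversely, every arrangement of 1, ..., m and M with this property is a word:
-- a first letter other than M and m would have both of them larger to its right.
oneLarger-complete : ∀ m {w} → m < M → w ↭ M ∷ applyUpTo suc m → OneLarger w →
                     Σ[ s ∈ Subset m ] word s M ≡ w
oneLarger-complete zero _ perm _ = [] , sym (↭-singleton-inv perm)
oneLarger-complete (suc m) {[]} _ perm _ = contradiction (↭-sym perm) ¬x∷xs↭[]
oneLarger-complete {M} (suc m) {a ∷ w} m<M perm one with ∈-resp-↭ perm (here refl)
... | here refl
  with s , eq ← oneLarger-complete m ≤-refl (↭-trans (drop-∷ perm) (interval-suc m))
                  (λ p<q q<t → one (s≤s p<q) (s≤s q<t))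
  = inside ∷ s , cong (M ∷_) eq
... | there a∈ with m≤n⇒m<n∨m≡n (proj₂ (∈-interval⁻ a∈))
...   | inj₂ refl
  with s , eq ← oneLarger-complete m (<⇒≤ m<M) (drop-∷ (↭-trans perm (interval-swap M m)))
                  (λ p<q q<t → one (s≤s p<q) (s≤s q<t))
  = outside ∷ s , cong (suc m ∷_) eq
...   | inj₁ a<1+m = ⊥-elim two-larger
  where
  a<M : a < M
  a<M = <-trans a<1+m m<M
  tail-∈ : ∀ {b} → a < b → b ∈ M ∷ applyUpTo suc (suc m) → b ∈ w
  tail-∈ a<b b∈ with ∈-resp-↭ (↭-sym perm) b∈
  ... | here refl = contradiction a<b (<-irrefl refl)
  ... | there b∈w = b∈w
  M∈ : M ∈ w
  M∈ = tail-∈ a<M (here refl)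
  1+m∈ : suc m ∈ w
  1+m∈ = tail-∈ a<1+m (there (∈-applyUpTo⁺ suc ≤-refl))
  a<M′ : a < lookup w (index M∈)
  a<M′ = subst (a <_) (lookup-index M∈) a<M
  a<1+m′ : a < lookup w (index 1+m∈)
  a<1+m′ = subst (a <_) (lookup-index 1+m∈) a<1+m
  two-larger : ⊥
  two-larger with Fin.<-cmp (index M∈) (index 1+m∈)
  ... | tri< lt _ _ = one {zero} (s≤s z≤n) (s≤s lt) a<M′ a<1+m′
  ... | tri> _ _ gt = one {zero} (s≤s z≤n) (s≤s gt) a<1+m′ a<M′
  ... | tri≈ _ eq _ = <⇒≢ m<M
    (trans (lookup-index 1+m∈) (trans (cong (lookup w) (sym eq)) (sym (lookup-index M∈))))

-- The positions p, q, t of a candidate occurrence of a pattern of length 3.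
triple : A → A → A → Fin 3 → A
triple x y z 0F = x
triple x y z 1F = y
triple x y z 2F = z

triple-mono : {p q t : Fin n} → p Fin.< q → q Fin.< t →
              ∀ {a b} → a Fin.< b → triple p q t a Fin.< triple p q t b
triple-mono p<q q<t {0F} {1F} _ = p<q
triple-mono p<q q<t {0F} {2F} _ = <-trans p<q q<t
triple-mono p<q q<t {1F} {2F} _ = q<t
triple-mono p<q q<t {0F} {0F} ()
triple-mono p<q q<t {1F} {0F} ()
triple-mono p<q q<t {1F} {1F} (s≤s ())
triple-mono p<q q<t {2F} {0F} ()
triple-mono p<q q<t {2F} {1F} (s≤s ())
triple-mono p<q q<t {2F} {2F} (s≤s (s≤s ()))

-- Two comparisons that both hold, or both fail, agree.
both-< : ∀ {a b c d} → a < b → c < d → a < b ⇔ c < d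
both-< a<b c<d = mk⇔ (λ _ → c<d) (λ _ → a<b)

both-≥ : ∀ {a b c d} → b ≤ a → d ≤ c → a < b ⇔ c < d
both-≥ b≤a d≤c = mk⇔ (λ a<b → contradiction a<b (≤⇒≯ b≤a)) (λ c<d → contradiction c<d (≤⇒≯ d≤c))

contains-123 : ∀ {w p q t} → p Fin.< q → q Fin.< t →
               lookup w p < lookup w q → lookup w q < lookup w t → Contains w (1 ∷ 2 ∷ 3 ∷ [])
contains-123 {w} {p} {q} {t} p<q q<t wp<wq wq<wt = triple p q t , triple-mono p<q q<t , λ where
  0F 0F → both-≥ ≤-refl ≤-refl
  0F 1F → both-< wp<wq ≤-refl
  0F 2F → both-< (<-trans wp<wq wq<wt) (s≤s (s≤s z≤n))
  1F 0F → both-≥ (<⇒≤ wp<wq) (s≤s z≤n)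
  1F 1F → both-≥ ≤-refl ≤-refl
  1F 2F → both-< wq<wt ≤-refl
  2F 0F → both-≥ (<⇒≤ (<-trans wp<wq wq<wt)) (s≤s z≤n)
  2F 1F → both-≥ (<⇒≤ wq<wt) (s≤s (s≤s z≤n))
  2F 2F → both-≥ ≤-refl ≤-refl

contains-132 : ∀ {w p q t} → p Fin.< q → q Fin.< t →
               lookup w p < lookup w t → lookup w t < lookup w q → Contains w (1 ∷ 3 ∷ 2 ∷ [])
contains-132 {w} {p} {q} {t} p<q q<t wp<wt wt<wq = triple p q t , triple-mono p<q q<t , λ where
  0F 0F → both-≥ ≤-refl ≤-refl
  0F 1F → both-< (<-trans wp<wt wt<wq) (s≤s (s≤s z≤n))
  0F 2F → both-< wp<wt ≤-refl
  1F 0F → both-≥ (<⇒≤ (<-trans wp<wt wt<wq)) (s≤s z≤n)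
  1F 1F → both-≥ ≤-refl ≤-refl
  1F 2F → both-≥ (<⇒≤ wt<wq) (s≤s (s≤s z≤n))
  2F 0F → both-≥ (<⇒≤ wp<wt) (s≤s z≤n)
  2F 1F → both-< wt<wq ≤-refl
  2F 2F → both-≥ ≤-refl ≤-refl

patterns : List Word
patterns = (1 ∷ 3 ∷ 2 ∷ []) ∷ (1 ∷ 2 ∷ 3 ∷ []) ∷ []

oneLarger⇒avoids : ∀ w → OneLarger w → All (Avoids w) patterns
oneLarger⇒avoids w one =
    (λ (i , mono , iso) →
      one (mono {0F} {1F} ≤-refl) (mono {1F} {2F} ≤-refl)
          (Equivalence.from (iso 0F 1F) (s≤s (s≤s z≤n))) (Equivalence.from (iso 0F 2F) ≤-refl))
  ∷ (λ (i , mono , iso) →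
      one (mono {0F} {1F} ≤-refl) (mono {1F} {2F} ≤-refl)
          (Equivalence.from (iso 0F 1F) ≤-refl) (Equivalence.from (iso 0F 2F) (s≤s (s≤s z≤n))))
  ∷ []

avoids⇒oneLarger : ∀ w → Unique w → All (Avoids w) patterns → OneLarger w
avoids⇒oneLarger w u (av132 ∷ av123 ∷ []) {p} {q} {t} p<q q<t wp<wq wp<wt
  with <-cmp (lookup w q) (lookup w t)
... | tri< wq<wt _ _ = av123 (contains-123 {w} p<q q<t wp<wq wq<wt)
... | tri≈ _ wq≡wt _ = lookup-≢ u q<t wq≡wt
... | tri> _ _ wt<wq = av132 (contains-132 {w} p<q q<t wp<wt wt<wq)

-- Counting indecomposable avoiding permutations

word-∈I : (s : Subset r) → 1 ≤ ∣ s ∣ → k ≡ r C 2 + ∣ s ∣ → I k patterns (word s (suc r))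
word-∈I s 1≤∣s∣ k≡ =
  word-isPermutation s , word-indecomposable s 1≤∣s∣ ,
  trans (word-inversions s ≤-refl) (sym k≡) , oneLarger⇒avoids (word s _) (word-oneLarger s ≤-refl)

word-cell : (s : Subset r) → 1 ≤ k → Indecomposable (word s (suc r)) → inversions (word s (suc r)) ≡ k →
            Cell k r ∣ s ∣
word-cell {zero}  []    1≤k _          inv =
  contradiction (trans (sym inv) (word-inversions [] ≤-refl)) (>⇒≢ 1≤k)
word-cell {suc r} s     1≤k (_ , ¬dec) inv = cell
  (n≢0⇒n>0 (¬dec ∘ word-decomposable s)) (∣p∣≤n s) (trans (sym inv) (word-inversions s ≤-refl))

I⇒word : ∀ {w} → 1 ≤ k → I k patterns w →
         ∃[ r ] Σ[ s ∈ Subset r ] word s (suc r) ≡ w × Cell k r ∣ s ∣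
I⇒word {w = []} _ (_ , (≢[] , _) , _) = contradiction refl ≢[]
I⇒word {w = w@(_ ∷ v)} 1≤k (perm , indec , inv , av)
  with s , eq ← oneLarger-complete (length v) ≤-refl (↭-trans perm (interval-suc (length v)))
                    (avoids⇒oneLarger w (Unique-resp-↭ (↭-sym perm) (interval-unique (length w))) av)
  = length v , s , eq ,
    word-cell s 1≤k (subst Indecomposable (sym eq) indec) (trans (cong inversions eq) inv)

-- For k in the cell (r , j) the permutations in I k are the words of the j-element
-- subsets of an r-element set; lengths other than r + 1 contribute nothing, because
-- the cell of k is unique.
row-cardinality : Cell k r j → HasCardinality (I k patterns) (r C j)
row-cardinality {k} {r} {j} c =
    map (λ s → word s (suc r)) (subsets r j)
  , Unique.map⁺ (word-injective _ _ ≤-refl) (subsets-unique r j)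
  , (λ w → mk⇔ to from)
  , trans (length-map _ (subsets r j)) (length-subsets r j)
  where
  to : ∀ {w} → w ∈ map (λ s → word s (suc r)) (subsets r j) → I k patterns w
  to w∈ with s , s∈ , refl ← ∈-map⁻ _ w∈ with refl ← ∈-subsets⁻ j s∈ = word-∈I s (1≤j c) (k≡ c)
  from : ∀ {w} → I k patterns w → w ∈ map (λ s → word s (suc r)) (subsets r j)
  from w∈I with r′ , s , refl , c′ ← I⇒word (≤-trans (s≤s z≤n) (cell-> c)) w∈I
    with refl , refl ← cell-unique c c′ = ∈-map⁺ _ (∈-subsets⁺ s)

-- The generating function

sum-zero : ∀ {n} (t : Fin n → ℤ) → (∀ i → t i ≡ 0ℤ) → sum t ≡ 0ℤ
sum-zero {n} t t≡0 = trans (sum-cong-≗ t≡0) (sum-replicate-zero n)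

sum-single : ∀ (t : ℕ → ℤ) i n → i < n → (∀ l → l ≢ i → t l ≡ 0ℤ) → sum {n} (t ∘ toℕ) ≡ t i
sum-single t zero    (suc n) _   t≡0 =
  trans (cong (λ z → t 0 ℤ.+ z) (sum-zero {n} _ (λ l → t≡0 _ λ ()))) (ℤ.+-identityʳ (t 0))
sum-single t (suc i) (suc n) i<n t≡0 =
  trans (cong₂ ℤ._+_ (t≡0 0 λ ())
                     (sum-single (t ∘ suc) i n (s<s⁻¹ i<n) (λ l l≢i → t≡0 _ (l≢i ∘ suc-injective))))
        (ℤ.+-identityˡ (t (suc i)))

-- Multiplication by x + 1 adds neighbouring coefficients.
x+1-* : ∀ f m → ((x +ₛ 1ₛ) *ₛ f) (suc m) ≡ f m ℤ.+ f (suc m)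
x+1-* f m = begin
  1ℤ ℤ.* f (suc m) ℤ.+ (1ℤ ℤ.* f m ℤ.+ sum {m} (λ i → 0ℤ))
    ≡⟨ cong₂ ℤ._+_ (ℤ.*-identityˡ (f (suc m))) (cong₂ ℤ._+_ (ℤ.*-identityˡ (f m)) (sum-replicate-zero m)) ⟩
  f (suc m) ℤ.+ (f m ℤ.+ 0ℤ)
    ≡⟨ cong (λ z → f (suc m) ℤ.+ z) (ℤ.+-identityʳ (f m)) ⟩
  f (suc m) ℤ.+ f m
    ≡⟨ ℤ.+-comm (f (suc m)) (f m) ⟩
  f m ℤ.+ f (suc m) ∎
  where open ≡-Reasoning

x+1-^ : ∀ n m → ((x +ₛ 1ₛ) ^ₛ n) m ≡ + (n C m)
x+1-^ zero    zero    = refl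
x+1-^ zero    (suc m) = refl
x+1-^ (suc n) zero    rewrite x+1-^ n 0 = refl
x+1-^ (suc n) (suc m) = begin
  ((x +ₛ 1ₛ) *ₛ ((x +ₛ 1ₛ) ^ₛ n)) (suc m)                  ≡⟨ x+1-* ((x +ₛ 1ₛ) ^ₛ n) m ⟩
  ((x +ₛ 1ₛ) ^ₛ n) m ℤ.+ ((x +ₛ 1ₛ) ^ₛ n) (suc m)  ≡⟨ cong₂ ℤ._+_ (x+1-^ n m) (x+1-^ n (suc m)) ⟩
  + (n C m + n C suc m)                                      ≡⟨ cong +_ (nCk+nC[k+1]≡[n+1]C[k+1] n m) ⟩
  + (suc n C suc m)                                          ∎
  where open ≡-Reasoning

-- The coefficients of (x + 1)^n - 1.
coeff : ℕ → ℕ → ℤ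
coeff n = (x +ₛ 1ₛ) ^ₛ n -ₛ 1ₛ

coeff-zero : ∀ n → coeff n 0 ≡ 0ℤ
coeff-zero n rewrite x+1-^ n 0 = refl

coeff-suc : ∀ n m → 1 ≤ m → coeff n m ≡ + (n C m)
coeff-suc n (suc m) _ = trans (ℤ.+-identityʳ _) (x+1-^ n (suc m))

triangle-double : ∀ n → (suc n C 2) * 2 ≡ suc n * n
triangle-double zero = refl
triangle-double (suc n) = begin
  (suc (suc n) C 2) * 2 ≡⟨ cong (_* 2) (triangle-suc (suc n)) ⟩
  (suc n + suc n C 2) * 2 ≡⟨ *-distribʳ-+ 2 (suc n) (suc n C 2) ⟩
  suc n * 2 + (suc n C 2) * 2 ≡⟨ cong (λ z → suc n * 2 + z) (triangle-double n) ⟩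
  suc n * 2 + suc n * n ≡⟨ lemma n ⟩
  suc (suc n) * suc n ∎
  where
  open ≡-Reasoning
  lemma : ∀ n → suc n * 2 + suc n * n ≡ suc (suc n) * suc n
  lemma = solve-∀

-- The exponent (n-2)(n+1)/2 is C(n,2) - 1, here with n + 1 for n.
-- At n = 1 it is -1.
exponent≡ : ∀ n → exponent (suc n) ≡ suc n C 2 ⊖ 1
exponent≡ zero = refl
-- From the second summand on both factors are natural numbers, and so is the quotient.
exponent≡ (suc n) = begin
  1ℤ ℤ.* ((+ n ℤ.* + (2 + n + 1)) ℤ./ℕ 2)
    ≡⟨ ℤ.*-identityˡ _ ⟩
  (+ n ℤ.* + (2 + n + 1)) ℤ./ℕ 2
    ≡⟨ cong (ℤ._/ℕ 2) (ℤ.pos-* n (2 + n + 1)) ⟨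
  + (n * (2 + n + 1) / 2)
    ≡⟨ cong (λ l → + (l / 2)) numerator ⟩
  + ((T ∸ 1) * 2 / 2)
    ≡⟨ cong +_ (m*n/n≡m (T ∸ 1) 2) ⟩
  + (T ∸ 1)
    ≡⟨ ℤ.⊖-≥ (triangle-mono {2} {suc (suc n)} (s≤s (s≤s z≤n))) ⟨
  T ⊖ 1 ∎
  where
  open ≡-Reasoning
  T = suc (suc n) C 2
  expand : ∀ n → suc (suc n) * suc n ≡ 2 + n * (2 + n + 1)
  expand = solve-∀
  numerator : n * (2 + n + 1) ≡ (T ∸ 1) * 2
  numerator = begin
    n * (2 + n + 1)         ≡⟨ cong (_∸ 2) (expand n) ⟨
    suc (suc n) * suc n ∸ 2 ≡⟨ cong (_∸ 2) (triangle-double (suc n)) ⟨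
    T * 2 ∸ 1 * 2           ≡⟨ *-distribʳ-∸ 2 T 1 ⟨
    (T ∸ 1) * 2             ∎

-- The n-th summand of the generating function.
term : ℕ → LaurentSeries
term n = x^ exponent n · toLaurent ((x +ₛ 1ₛ) ^ₛ n -ₛ 1ₛ)

-- The coefficient of x^i in the (n+1)-st summand is the coefficient of
-- (x + 1)^(n+1) - 1 at i + 1 - C(n+1,2).
term≡ : ∀ n i → term (suc n) i ≡ toLaurent (coeff (suc n)) (ℤ.suc i ℤ.- + (suc n C 2))
term≡ n i = cong (toLaurent (coeff (suc n))) (begin
  i ℤ.- exponent (suc n)          ≡⟨ cong (λ z → i ℤ.- z) (exponent≡ n) ⟩
  i ℤ.- (T ⊖ 1)                   ≡⟨ cong (λ z → i ℤ.+ z) (ℤ.⊖-swap 1 T) ⟨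
  i ℤ.+ (1 ⊖ T)                   ≡⟨ cong (λ z → i ℤ.+ z) (ℤ.m-n≡m⊖n 1 T) ⟨
  i ℤ.+ (1ℤ ℤ.- + T)              ≡⟨ ℤ.+-assoc i 1ℤ (ℤ.- + T) ⟨
  i ℤ.+ 1ℤ ℤ.- + T                ≡⟨ cong (ℤ._- + T) (ℤ.+-comm i 1ℤ) ⟩
  ℤ.suc i ℤ.- + T                 ∎)
  where
  open ≡-Reasoning
  T = suc n C 2

coeff-nonpositive : ∀ n q → toLaurent (coeff n) (ℤ.- + q) ≡ 0ℤ
coeff-nonpositive n zero    = coeff-zero n
coeff-nonpositive n (suc q) = refl

term-negative : ∀ n p → term (suc n) -[1+ p ] ≡ 0ℤ
term-negative n p = begin
  term (suc n) -[1+ p ]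
    ≡⟨ term≡ n -[1+ p ] ⟩
  toLaurent (coeff (suc n)) (ℤ.suc -[1+ p ] ℤ.- + T)
    ≡⟨ cong (λ i → toLaurent (coeff (suc n)) (i ℤ.- + T))
         (trans (ℤ.[1+m]⊖[1+n]≡m⊖n 0 p) (ℤ.⊖-≤ {0} {p} z≤n)) ⟩
  toLaurent (coeff (suc n)) (ℤ.- + p ℤ.- + T)
    ≡⟨ cong (toLaurent (coeff (suc n))) (ℤ.neg-distrib-+ (+ p) (+ T)) ⟨
  toLaurent (coeff (suc n)) (ℤ.- + (p + T))
    ≡⟨ coeff-nonpositive (suc n) (p + T) ⟩
  0ℤ ∎
  where
  open ≡-Reasoning
  T = suc n C 2

term⊖ : ∀ n p → term (suc n) (+ p) ≡ toLaurent (coeff (suc n)) (suc p ⊖ (suc n C 2))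
term⊖ n p = trans (term≡ n (+ p)) (cong (toLaurent (coeff (suc n))) (ℤ.m-n≡m⊖n (suc p) (suc n C 2)))

term-≤ : ∀ n p → suc p ≤ suc n C 2 → term (suc n) (+ p) ≡ 0ℤ
term-≤ n p p<T = trans (term⊖ n p)
  (trans (cong (toLaurent (coeff (suc n))) (ℤ.⊖-≤ p<T))
         (coeff-nonpositive (suc n) (suc n C 2 ∸ suc p)))

term-> : ∀ n p j → 1 ≤ j → suc p ≡ suc n C 2 + j → term (suc n) (+ p) ≡ + (suc n C j)
term-> n p j 1≤j eq = begin
  term (suc n) (+ p)                                  ≡⟨ term⊖ n p ⟩
  toLaurent (coeff (suc n)) (suc p ⊖ T)       ≡⟨ cong (λ l → toLaurent (coeff (suc n)) (l ⊖ T)) eq ⟩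
  toLaurent (coeff (suc n)) (T + j ⊖ T)       ≡⟨ cong (toLaurent (coeff (suc n))) (ℤ.⊖-≥ (m≤m+n T j)) ⟩
  coeff (suc n) (T + j ∸ T)                           ≡⟨ cong (coeff (suc n)) (m+n∸m≡n T j) ⟩
  coeff (suc n) j                                     ≡⟨ coeff-suc (suc n) j 1≤j ⟩
  + (suc n C j)                                       ∎
  where
  open ≡-Reasoning
  T = suc n C 2

-- Outside the row r of k = p + 1 the coefficient vanishes: for n > r because
-- k ≤ C(n,2), and for n < r because k - C(n,2) exceeds n.
term-other : ∀ {p} n → Cell (suc p) r j → suc n ≢ r → term (suc n) (+ p) ≡ 0ℤ
term-other {r} {j} {p} n c n≢r with <-cmp (suc n) r
... | tri≈ _ eq _ = contradiction eq n≢r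
... | tri> _ _ r<n = term-≤ n p (cell-≤-next c r<n)
... | tri< n<r _ _ = trans (term-> n p (suc p ∸ T) (m<n⇒0<n∸m T<1+p) (sym (m+[n∸m]≡n (<⇒≤ T<1+p))))
                           (cong +_ (k>n⇒nCk≡0 n<j))
  where
  T = suc n C 2
  next : suc n + T < suc p
  next = ≤-<-trans (≤-trans (≤-reflexive (sym (triangle-suc (suc n)))) (triangle-mono n<r)) (cell-> c)
  T<1+p : T < suc p
  T<1+p = ≤-<-trans (m≤n+m T (suc n)) next
  n<j : suc n < suc p ∸ T
  n<j = m+n≤o⇒m≤o∸n (suc (suc n)) next

-- Pascal's triangle without its first column, read row by row from index 1.
-- Index 0 is no position of the triangle; its value 1 is the number of
-- indecomposable permutations without inversions.
pascal : ℕ → ℕ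
pascal zero    = 1
pascal (suc p) = let r , j , _ = locate p in r C j

pascal-cell : Cell k r j → pascal k ≡ r C j
pascal-cell {zero} c = contradiction (cell-> c) λ ()
pascal-cell {suc p} c with r′ , j′ , c′ ← locate p with refl , refl ← cell-unique c c′ = refl

-- A coefficient at x^p, p ≥ 0, is stable as soon as the row r of p + 1 is among the
-- summands; the coefficients at negative exponents vanish in every summand.
series : Σₙ≥1 term ≈ toLaurent (λ m → + pascal (suc m))
series -[1+ p ] = 0 , λ N _ → sum-zero {N} _ (λ i → term-negative (toℕ i) p)
series (+ p) with locate p
... | zero  , j , c = contradiction (≤-trans (1≤j c) (j≤r c)) λ ()
... | suc r , j , c = suc r , λ N r<N →
  trans (sum-single (λ i → term (suc i) (+ p)) r N r<N (λ l l≢r → term-other l c (l≢r ∘ suc-injective)))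
        (term-> r p j (1≤j c) (k≡ c))

theorem13 : Σ[ ∣I∣ ∈ (ℕ → ℕ) ]
    (∀ k → 1 ≤ k → HasCardinality (I k ((1 ∷ 3 ∷ 2 ∷ []) ∷ (1 ∷ 2 ∷ 3 ∷ []) ∷ [])) (∣I∣ k)) ×
    (∀ r j → 1 ≤ r → 1 ≤ j → j ≤ r → ∣I∣ ((r C 2) + j) ≡ r C j) ×
    (Σₙ≥1 (λ n → x^ exponent n · toLaurent ((x +ₛ 1ₛ) ^ₛ n -ₛ 1ₛ)) ≈ toLaurent (λ m → + ∣I∣ (suc m)))
theorem13 = pascal
  , (λ { (suc p) _ → row-cardinality (proj₂ (proj₂ (locate p))) })
  , (λ r j _ 1≤j j≤r → pascal-cell (cell 1≤j j≤r refl))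
  , series
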